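{- Let $U$ be a nonempty set. For every MSO formula $\varphi$, the following are equivalent: (i) for every interpretation $II$ over $U$ and all assignments $gg:V\to U$, $GG:V_2\to\mathcal P(U)$, the proposition $(\!|\varphi|\!)_{II,gg,GG}$ is true; (ii) for every interpretation $I$ over $U$ and all assignments $g:V\to U$, $G:V_2\to\mathcal P(U)$, $\langle I,\mathrm{Range}(g),\mathrm{Range}(G)\rangle,g,G\models^d\varphi$.
   Context: **Syntax.** Relation symbols $R=\mathbb N$, first-order variables $V=\mathbb N$ and second-order (monadic) variables $V_2=\mathbb N$ (the two kinds of variables form separate namespaces). MSO formulas: $\varphi,\psi ::= r(x,y)\mid X(x)\mid\neg\varphi\mid\varphi\wedge\psi\mid\exists x.\varphi\mid\exists X.\varphi$ with $r\in R$, $x,y\in V$, $X\in V_2$ (no equality). **Semantics.** $U$ is a fixed nonempty set (the type of individuals). An interpretation $I$ over $U$ assigns to each $r\in R$ a binary relation $I(r)\subseteq U\times U$. Given $I$, a set $D\subseteq U$, a family $E\subseteq\mathcal P(U)$ (no closure condition on $E$), and assignments $g:V\to U$, $G:V_2\to\mathcal P(U)$, truth $\langle I,D,E\rangle,g,G\models^d\varphi$ is defined recursively: $r(x,y)$ holds iff $(g(x),g(y))\in I(r)$; $X(x)$ holds iff $g(x)\in G(X)$; $\neg,\wedge$ are classical; $\exists x.\varphi$ holds iff $\langle I,D,E\rangle,g[x\leftarrow d],G\models^d\varphi$ for some $d\in D$; $\exists X.\varphi$ holds iff $\langle I,D,E\rangle,g,G\langle X\leftarrow S\rangle\models^d\varphi$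 for some $S\in E$. Here $g[x\leftarrow d]$ and $G\langle X\leftarrow S\rangle$ are the usual updates. **Safe substitution.** $[x\leftarrow_r z](\varphi)$ (for $x,z\in V$) is capture-avoiding substitution: first rename every binder $\exists z$ in $\varphi$, together with the occurrences it binds, to $\exists w$ for a fresh variable $w$ (say the least one not occurring in $\varphi$ and different from $x,z$), then replace all free occurrences of $x$ by $z$. $[X\leftarrow_{r2}Z](\varphi)$ for $X,Z\in V_2$ is the analogous operation for second-order variables. Binders of one namespace do not interact with substitution in the other. Both operations preserve formula size. **Minimal-shallow translation.** For parameters $II$ (an interpretation over $U$), $gg:V\to U$, $GG:V_2\to\mathcal P(U)$, the truth value $(\!|\varphi|\!)=(\!|\varphi|\!)_{II,gg,GG}$ is defined by recursion on formula size: $(\!|r(x,y)|\!)$ is $(gg(x),gg(y))\in II(r)$; $(\!|X(x)|\!)$ is $gg(x)\in GG(X)$; $(\!|\neg\varphi|\!)$ is $\neg(\!|\varphi|\!)$; $(\!|\varphi\wedge\psi|\!)$ is $(\!|\varphi|\!)\wedge(\!|\psi|\!)$; $(\!|\exists x.\varphi|\!)$ is "there is a variable $z\in V$ with $(\!|[x\leftarrow_r z](\varphi)|\!)$"; $(\!|\exists X.\varphi|\!)$ is "there is a variable $Z\in V_2$ with $(\!|[X\leftarrow_{r2}Z](\varphi)|\!)$". -}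

module Defs where

open import Level using (Level; Lift) renaming (suc to lsuc)
open import Data.Bool using (if_then_else_)
open import Data.List using (List; []; _∷_; _++_)
open import Data.List.Extrema.Nat using (max; xs≤max)
open import Data.List.Membership.Propositional using () renaming (_∈_ to _∈ₗ_; _∉_ to _∉ₗ_)
open import Data.List.Membership.DecPropositional using () renaming (_∈?_ to mem?)
open import Data.List.Relation.Unary.All using () renaming (lookup to All-lookup)
open import Data.Nat using (ℕ; zero; suc; _+_; _≤_; _<_; s≤s; _≟_)
open import Data.Nat.Induction using (<-wellFounded)
open import Data.Nat.Properties
  using (≤-reflexive; <⇒≱; +-identityʳ; +-suc; m≤n⇒m<n∨m≡n; ≤-pred; n<1+n; m≤m+n; m≤n+m)
open import Data.Product using (∃; _×_)
open import Data.Sum using (inj₁; inj₂)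
open import Function using (id)
open import Induction.WellFounded using (Acc; acc)
open import Relation.Binary.Core using (Rel)
open import Relation.Binary.PropositionalEquality
  using (_≡_; refl; sym; trans; cong; cong₂; subst)
open import Relation.Nullary using (¬_; yes; no; ⌊_⌋)
open import Relation.Unary using (Pred; _∈_; _≐_)

private
  variable
    a ℓ : Level

R V V₂ : Set
R  = ℕ
V  = ℕ
V₂ = ℕ

infix  9 _⟨_,_⟩ _⟨_⟩
infix  8 `¬_
infixr 7 _`∧_
infix  6 `∃_∙_ `∃₂_∙_

data Formula : Set where
  _⟨_,_⟩ : R → V → V → Formula
  _⟨_⟩   : V₂ → V → Formula
  `¬_    : Formula → Formula
  _`∧_   : Formula → Formula → Formula
  `∃_∙_  : V → Formula → Formula
  `∃₂_∙_ : V₂ → Formula → Formula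

size : Formula → ℕ
size (r ⟨ x , y ⟩) = 1
size (X ⟨ x ⟩)     = 1
size (`¬ φ)        = suc (size φ)
size (φ `∧ ψ)      = suc (size φ + size ψ)
size (`∃ x ∙ φ)    = suc (size φ)
size (`∃₂ X ∙ φ)   = suc (size φ)

infixl 10 _[_←_]

_[_←_] : {A : Set a} → (ℕ → A) → ℕ → A → ℕ → A
(f [ x ← d ]) y = if ⌊ y ≟ x ⌋ then d else f y

Interpretation : Set ℓ → Set (lsuc ℓ)
Interpretation {ℓ} U = R → Rel U ℓ

infix 4 ⟨_,_,_⟩,_,_⊨ᵈ_

-- Truth values live in Set (lsuc ℓ) because ∃X ranges over subsets of U;
-- this is why the other clauses are lifted.
⟨_,_,_⟩,_,_⊨ᵈ_ : {U : Set ℓ} →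
  Interpretation U → Pred U ℓ → Pred (Pred U ℓ) ℓ →
  (V → U) → (V₂ → Pred U ℓ) → Formula → Set (lsuc ℓ)
⟨_,_,_⟩,_,_⊨ᵈ_ {ℓ} I D E g G (r ⟨ x , y ⟩) = Lift (lsuc ℓ) (I r (g x) (g y))
⟨_,_,_⟩,_,_⊨ᵈ_ {ℓ} I D E g G (X ⟨ x ⟩)     = Lift (lsuc ℓ) (g x ∈ G X)
⟨ I , D , E ⟩, g , G ⊨ᵈ (`¬ φ)      = ¬ (⟨ I , D , E ⟩, g , G ⊨ᵈ φ)
⟨ I , D , E ⟩, g , G ⊨ᵈ (φ `∧ ψ)    =
  (⟨ I , D , E ⟩, g , G ⊨ᵈ φ) × (⟨ I , D , E ⟩, g , G ⊨ᵈ ψ)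
⟨ I , D , E ⟩, g , G ⊨ᵈ (`∃ x ∙ φ)  =
  ∃ λ d → d ∈ D × (⟨ I , D , E ⟩, g [ x ← d ] , G ⊨ᵈ φ)
⟨ I , D , E ⟩, g , G ⊨ᵈ (`∃₂ X ∙ φ) =
  ∃ λ S → S ∈ E × (⟨ I , D , E ⟩, g , G [ X ← S ] ⊨ᵈ φ)

Range : {U : Set ℓ} → (V → U) → Pred U ℓ
Range g d = ∃ λ x → g x ≡ d

-- Subsets of U are predicates, so their equality is the extensional one.
Range₂ : {U : Set ℓ} → (V₂ → Pred U ℓ) → Pred (Pred U ℓ) ℓ
Range₂ G S = ∃ λ X → G X ≐ S

-- Bound variables count as occurring, even if they bind nothing.
vars : Formula → List V
vars (r ⟨ x , y ⟩) = x ∷ y ∷ []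
vars (X ⟨ x ⟩)     = x ∷ []
vars (`¬ φ)        = vars φ
vars (φ `∧ ψ)      = vars φ ++ vars ψ
vars (`∃ x ∙ φ)    = x ∷ vars φ
vars (`∃₂ X ∙ φ)   = vars φ

vars₂ : Formula → List V₂
vars₂ (r ⟨ x , y ⟩) = []
vars₂ (X ⟨ x ⟩)     = X ∷ []
vars₂ (`¬ φ)        = vars₂ φ
vars₂ (φ `∧ ψ)      = vars₂ φ ++ vars₂ ψ
vars₂ (`∃ x ∙ φ)    = vars₂ φ
vars₂ (`∃₂ X ∙ φ)   = X ∷ vars₂ φ

-- The first of k, k + 1, …, k + n not in xs (k + n if there is none before it).
search : ℕ → ℕ → List ℕ → ℕ
search zero    k xs = k
search (suc n) k xs = if ⌊ mem? _≟_ k xs ⌋ then search n (suc k) xs else k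

fresh : List ℕ → ℕ
fresh xs = search (suc (max 0 xs)) 0 xs

fresh-∉ : ∀ xs → fresh xs ∉ₗ xs
fresh-∉ xs = go (suc (max 0 xs)) 0 refl
  where
  go : ∀ n k → k + n ≡ suc (max 0 xs) → search n k xs ∉ₗ xs
  go zero k eq k∈xs = <⇒≱ (n<1+n (max 0 xs))
    (subst (_≤ max 0 xs) (trans (sym (+-identityʳ k)) eq) (All-lookup (xs≤max 0 xs) k∈xs))
  go (suc n) k eq with mem? _≟_ k xs
  ... | yes _    = go n (suc k) (trans (sym (+-suc k n)) eq)
  ... | no  k∉xs = k∉xs

fresh-least : ∀ xs {v} → v < fresh xs → v ∈ₗ xs
fresh-least xs = go (suc (max 0 xs)) 0 (λ ())
  where
  go : ∀ n k → (∀ {v} → v < k → v ∈ₗ xs) → ∀ {v} → v < search n k xs → v ∈ₗ xs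
  go zero    k below = below
  go (suc n) k below with mem? _≟_ k xs
  ... | no  _    = below
  ... | yes k∈xs = go n (suc k) below′
    where
    below′ : ∀ {v} → v < suc k → v ∈ₗ xs
    below′ v<1+k with m≤n⇒m<n∨m≡n (≤-pred v<1+k)
    ... | inj₁ v<k  = below v<k
    ... | inj₂ refl = k∈xs

-- Replaces the free occurrences of x by z, with no regard to capture.
replace : V → V → Formula → Formula
replace x z (r ⟨ y , y′ ⟩) = r ⟨ (id [ x ← z ]) y , (id [ x ← z ]) y′ ⟩
replace x z (X ⟨ y ⟩)      = X ⟨ (id [ x ← z ]) y ⟩
replace x z (`¬ φ)         = `¬ replace x z φ
replace x z (φ `∧ ψ)       = replace x z φ `∧ replace x z ψ
replace x z (`∃ y ∙ φ)     = `∃ y ∙ (if ⌊ y ≟ x ⌋ then φ else replace x z φ)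
replace x z (`∃₂ X ∙ φ)    = `∃₂ X ∙ replace x z φ

replace₂ : V₂ → V₂ → Formula → Formula
replace₂ X Z (r ⟨ y , y′ ⟩) = r ⟨ y , y′ ⟩
replace₂ X Z (Y ⟨ y ⟩)      = (id [ X ← Z ]) Y ⟨ y ⟩
replace₂ X Z (`¬ φ)         = `¬ replace₂ X Z φ
replace₂ X Z (φ `∧ ψ)       = replace₂ X Z φ `∧ replace₂ X Z ψ
replace₂ X Z (`∃ y ∙ φ)     = `∃ y ∙ replace₂ X Z φ
replace₂ X Z (`∃₂ Y ∙ φ)    = `∃₂ Y ∙ (if ⌊ Y ≟ X ⌋ then φ else replace₂ X Z φ)

-- Renames every binder ∃z, together with the occurrences it binds, to ∃w. The
-- inner binders are renamed first, so the z still free in the renamed body are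
-- exactly the occurrences bound by the outer binder.
rename : V → V → Formula → Formula
rename z w (r ⟨ y , y′ ⟩) = r ⟨ y , y′ ⟩
rename z w (X ⟨ y ⟩)      = X ⟨ y ⟩
rename z w (`¬ φ)         = `¬ rename z w φ
rename z w (φ `∧ ψ)       = rename z w φ `∧ rename z w ψ
rename z w (`∃ y ∙ φ)     =
  if ⌊ y ≟ z ⌋ then `∃ w ∙ replace z w (rename z w φ) else `∃ y ∙ rename z w φ
rename z w (`∃₂ X ∙ φ)    = `∃₂ X ∙ rename z w φ

rename₂ : V₂ → V₂ → Formula → Formula
rename₂ Z W (r ⟨ y , y′ ⟩) = r ⟨ y , y′ ⟩
rename₂ Z W (X ⟨ y ⟩)      = X ⟨ y ⟩
rename₂ Z W (`¬ φ)         = `¬ rename₂ Z W φ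
rename₂ Z W (φ `∧ ψ)       = rename₂ Z W φ `∧ rename₂ Z W ψ
rename₂ Z W (`∃ y ∙ φ)     = `∃ y ∙ rename₂ Z W φ
rename₂ Z W (`∃₂ Y ∙ φ)    =
  if ⌊ Y ≟ Z ⌋ then `∃₂ W ∙ replace₂ Z W (rename₂ Z W φ) else `∃₂ Y ∙ rename₂ Z W φ

infix 10 [_←ᵣ_]_ [_←ᵣ₂_]_

[_←ᵣ_]_ : V → V → Formula → Formula
[ x ←ᵣ z ] φ = replace x z (rename z (fresh (x ∷ z ∷ vars φ)) φ)

[_←ᵣ₂_]_ : V₂ → V₂ → Formula → Formula
[ X ←ᵣ₂ Z ] φ = replace₂ X Z (rename₂ Z (fresh (X ∷ Z ∷ vars₂ φ)) φ)

size-replace : ∀ x z φ → size (replace x z φ) ≡ size φ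
size-replace x z (r ⟨ y , y′ ⟩) = refl
size-replace x z (X ⟨ y ⟩)      = refl
size-replace x z (`¬ φ)         = cong suc (size-replace x z φ)
size-replace x z (φ `∧ ψ)       =
  cong suc (cong₂ _+_ (size-replace x z φ) (size-replace x z ψ))
size-replace x z (`∃ y ∙ φ) with y ≟ x
... | yes _ = refl
... | no  _ = cong suc (size-replace x z φ)
size-replace x z (`∃₂ X ∙ φ)    = cong suc (size-replace x z φ)

size-replace₂ : ∀ X Z φ → size (replace₂ X Z φ) ≡ size φ
size-replace₂ X Z (r ⟨ y , y′ ⟩) = refl
size-replace₂ X Z (Y ⟨ y ⟩)      = refl
size-replace₂ X Z (`¬ φ)         = cong suc (size-replace₂ X Z φ)
size-replace₂ X Z (φ `∧ ψ)       =
  cong suc (cong₂ _+_ (size-replace₂ X Z φ) (size-replace₂ X Z ψ))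
size-replace₂ X Z (`∃ y ∙ φ)     = cong suc (size-replace₂ X Z φ)
size-replace₂ X Z (`∃₂ Y ∙ φ) with Y ≟ X
... | yes _ = refl
... | no  _ = cong suc (size-replace₂ X Z φ)

size-rename : ∀ z w φ → size (rename z w φ) ≡ size φ
size-rename z w (r ⟨ y , y′ ⟩) = refl
size-rename z w (X ⟨ y ⟩)      = refl
size-rename z w (`¬ φ)         = cong suc (size-rename z w φ)
size-rename z w (φ `∧ ψ)       =
  cong suc (cong₂ _+_ (size-rename z w φ) (size-rename z w ψ))
size-rename z w (`∃ y ∙ φ) with y ≟ z
... | yes _ = cong suc (trans (size-replace z w (rename z w φ)) (size-rename z w φ))
... | no  _ = cong suc (size-rename z w φ)
size-rename z w (`∃₂ X ∙ φ)    = cong suc (size-rename z w φ)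

size-rename₂ : ∀ Z W φ → size (rename₂ Z W φ) ≡ size φ
size-rename₂ Z W (r ⟨ y , y′ ⟩) = refl
size-rename₂ Z W (X ⟨ y ⟩)      = refl
size-rename₂ Z W (`¬ φ)         = cong suc (size-rename₂ Z W φ)
size-rename₂ Z W (φ `∧ ψ)       =
  cong suc (cong₂ _+_ (size-rename₂ Z W φ) (size-rename₂ Z W ψ))
size-rename₂ Z W (`∃ y ∙ φ)     = cong suc (size-rename₂ Z W φ)
size-rename₂ Z W (`∃₂ Y ∙ φ) with Y ≟ Z
... | yes _ = cong suc (trans (size-replace₂ Z W (rename₂ Z W φ)) (size-rename₂ Z W φ))
... | no  _ = cong suc (size-rename₂ Z W φ)

size-subst : ∀ x z φ → size ([ x ←ᵣ z ] φ) ≡ size φ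
size-subst x z φ = trans (size-replace x z (rename z w φ)) (size-rename z w φ)
  where w = fresh (x ∷ z ∷ vars φ)

size-subst₂ : ∀ X Z φ → size ([ X ←ᵣ₂ Z ] φ) ≡ size φ
size-subst₂ X Z φ = trans (size-replace₂ X Z (rename₂ Z W φ)) (size-rename₂ Z W φ)
  where W = fresh (X ∷ Z ∷ vars₂ φ)

module _ {U : Set ℓ} (II : Interpretation U) (gg : V → U) (GG : V₂ → Pred U ℓ) where

  shallow : (φ : Formula) → Acc _<_ (size φ) → Set ℓ
  shallow (r ⟨ x , y ⟩) _        = II r (gg x) (gg y)
  shallow (X ⟨ x ⟩)     _        = gg x ∈ GG X
  shallow (`¬ φ)        (acc rs) = ¬ shallow φ (rs (n<1+n (size φ)))
  shallow (φ `∧ ψ)      (acc rs) =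
    shallow φ (rs (s≤s (m≤m+n (size φ) (size ψ)))) ×
    shallow ψ (rs (s≤s (m≤n+m (size ψ) (size φ))))
  shallow (`∃ x ∙ φ)    (acc rs) =
    ∃ λ (z : V) → shallow ([ x ←ᵣ z ] φ) (rs (≤-reflexive (cong suc (size-subst x z φ))))
  shallow (`∃₂ X ∙ φ)   (acc rs) =
    ∃ λ (Z : V₂) → shallow ([ X ←ᵣ₂ Z ] φ) (rs (≤-reflexive (cong suc (size-subst₂ X Z φ))))

⦅_⦆ : Formula → {U : Set ℓ} → Interpretation U → (V → U) → (V₂ → Pred U ℓ) → Set ℓ
⦅ φ ⦆ II gg GG = shallow II gg GG φ (<-wellFounded (size φ))

{-# OPTIONS --safe #-}

-- The equivalence holds pointwise: with domains D = Range gg and E = Range₂ GG, the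
-- shallow and the deep truth value of φ agree under the same assignments gg and GG.
-- D and E do not change under updates, so the quantifier clauses reduce to the
-- substitution lemma: [ x ←ᵣ z ] φ holds under g iff φ holds under g [ x ← g z ].

module Submission where

open import Defs
open import Level using (Level; lift) renaming (suc to lsuc)
open import Data.List using (_∷_)
open import Data.List.Membership.Propositional using () renaming (_∈_ to _∈ₗ_; _∉_ to _∉ₗ_)
open import Data.List.Membership.Propositional.Properties using (∈-++⁺ˡ; ∈-++⁺ʳ)
open import Data.List.Relation.Unary.Any using (here; there)
open import Data.Nat using (ℕ; _<_; _≟_)
open import Data.Nat.Induction using (<-wellFounded)
open import Data.Product using (∃; _×_; proj₁; proj₂; map₂)
open import Data.Product.Function.NonDependent.Propositional using (_×-⇔_)
open import Function using (id; _∘_)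
open import Function.Bundles using (_⇔_; mk⇔; module Equivalence)
open import Function.Construct.Composition using (_⇔-∘_)
open import Function.Related.TypeIsomorphisms using (¬-cong-⇔)
open import Induction.WellFounded using (Acc; acc)
open import Relation.Binary.Core using (Rel)
open import Relation.Binary.PropositionalEquality
  using (_≡_; _≢_; refl; sym; trans; cong; cong₂)
open import Relation.Nullary using (yes; no; contradiction)
open import Relation.Unary using (Pred; _∈_; _≐_)
open import Relation.Unary.Properties using (≐-refl; ≐-sym)

private
  variable
    a p q r ℓ : Level
    A : Set a
    v w x y z W X Y Z : ℕ
    φ : Formula

∃-cong-⇔ : {P : A → Set p} {Q : A → Set q} → (∀ x → P x ⇔ Q x) → ∃ P ⇔ ∃ Q
∃-cong-⇔ P⇔Q = mk⇔ (map₂ (Equivalence.to (P⇔Q _))) (map₂ (Equivalence.from (P⇔Q _)))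

≡⇒≐ : {P Q : Pred A ℓ} → P ≡ Q → P ≐ Q
≡⇒≐ refl = ≐-refl

-- Updates

update-same : (f : ℕ → A) (x : ℕ) (d : A) → (f [ x ← d ]) x ≡ d
update-same f x d with x ≟ x
... | yes _   = refl
... | no  x≢x = contradiction refl x≢x

update-other : (f : ℕ → A) {d : A} → y ≢ x → (f [ x ← d ]) y ≡ f y
update-other {y = y} {x = x} f y≢x with y ≟ x
... | yes y≡x = contradiction y≡x y≢x
... | no  _   = refl

-- The relation is a parameter so that one argument serves both equality of values and, as `≐`,
-- extensional equality of subsets.
update-rel : (_~_ : Rel A r) (f f′ : ℕ → A) {d d′ : A} (y : ℕ) →
  d ~ d′ → (y ≢ x → f y ~ f′ y) → (f [ x ← d ]) y ~ (f′ [ x ← d′ ]) y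
update-rel {x = x} _~_ f f′ y d~d′ f~f′ with y ≟ x
... | yes _   = d~d′
... | no  y≢x = f~f′ y≢x

update-cong : (f f′ : ℕ → A) {d d′ : A} (y : ℕ) →
  d ≡ d′ → (y ≢ x → f y ≡ f′ y) → (f [ x ← d ]) y ≡ (f′ [ x ← d′ ]) y
update-cong = update-rel _≡_

update-overwrite : (f : ℕ → A) {d e : A} (y : ℕ) →
  (f [ x ← d ]) y ≡ (f [ x ← e ] [ x ← d ]) y
update-overwrite {x = x} f {e = e} y =
  update-cong f (f [ x ← e ]) y refl (λ y≢x → sym (update-other f y≢x))

update-comm : (f : ℕ → A) {d e e′ : A} (v : ℕ) → x ≢ y → e ≡ e′ →
  (f [ x ← d ] [ y ← e ]) v ≡ (f [ y ← e′ ] [ x ← d ]) v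
update-comm {x = x} {y = y} f v x≢y refl with v ≟ y | v ≟ x
... | yes refl | yes refl = contradiction refl x≢y
... | yes _    | no  _    = refl
... | no  _    | yes _    = refl
... | no  _    | no  _    = refl

-- This is the substitution lemma at the level of a single variable, and it settles the atomic
-- cases.
update-id : (f : ℕ → A) (y : ℕ) → f ((id [ x ← z ]) y) ≡ (f [ x ← f z ]) y
update-id {x = x} f y with y ≟ x
... | yes _ = refl
... | no  _ = refl

update-id-idem : w ≢ z → ∀ y → (id [ z ← w ]) ((id [ z ← w ]) y) ≡ (id [ z ← w ]) y
update-id-idem {w} {z} w≢z y with y ≟ z
... | yes _   = update-other id w≢z
... | no  y≢z = update-other id y≢z

-- Replacement and renaming

-- As `w` differs from `z`, the first replacement leaves no free `z` for the second one to act on.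
replace-idem : w ≢ z → ∀ φ → replace z w (replace z w φ) ≡ replace z w φ
replace-idem w≢z (r ⟨ x , y ⟩) =
  cong₂ (r ⟨_,_⟩) (update-id-idem w≢z x) (update-id-idem w≢z y)
replace-idem w≢z (X ⟨ x ⟩)     = cong (X ⟨_⟩) (update-id-idem w≢z x)
replace-idem w≢z (`¬ φ)        = cong `¬_ (replace-idem w≢z φ)
replace-idem w≢z (φ `∧ ψ)      = cong₂ _`∧_ (replace-idem w≢z φ) (replace-idem w≢z ψ)
replace-idem {z = z} w≢z (`∃ y ∙ φ) with y ≟ z
... | yes _ = refl
... | no  _ = cong (`∃ y ∙_) (replace-idem w≢z φ)
replace-idem w≢z (`∃₂ X ∙ φ)   = cong (`∃₂ X ∙_) (replace-idem w≢z φ)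

replace₂-idem : W ≢ Z → ∀ φ → replace₂ Z W (replace₂ Z W φ) ≡ replace₂ Z W φ
replace₂-idem W≢Z (r ⟨ x , y ⟩) = refl
replace₂-idem W≢Z (X ⟨ x ⟩)     = cong (_⟨ x ⟩) (update-id-idem W≢Z X)
replace₂-idem W≢Z (`¬ φ)        = cong `¬_ (replace₂-idem W≢Z φ)
replace₂-idem W≢Z (φ `∧ ψ)      = cong₂ _`∧_ (replace₂-idem W≢Z φ) (replace₂-idem W≢Z ψ)
replace₂-idem W≢Z (`∃ y ∙ φ)    = cong (`∃ y ∙_) (replace₂-idem W≢Z φ)
replace₂-idem {Z = Z} W≢Z (`∃₂ X ∙ φ) with X ≟ Z
... | yes _ = refl
... | no  _ = cong (`∃₂ X ∙_) (replace₂-idem W≢Z φ)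

-- Stronger than the usual "`z` is free for `x`": every binder of `z` is excluded, whether or not a
-- free `x` lies below it. The condition thus does not mention `x`, and renaming alone can establish
-- it.
data NotBound (z : V) : Formula → Set where
  rel   : ∀ {r x y} → NotBound z (r ⟨ x , y ⟩)
  app   : NotBound z (X ⟨ x ⟩)
  neg   : NotBound z φ → NotBound z (`¬ φ)
  conj  : ∀ {φ ψ} → NotBound z φ → NotBound z ψ → NotBound z (φ `∧ ψ)
  bind  : y ≢ z → NotBound z φ → NotBound z (`∃ y ∙ φ)
  bind₂ : NotBound z φ → NotBound z (`∃₂ X ∙ φ)

data NotBound₂ (Z : V₂) : Formula → Set where
  rel   : ∀ {r x y} → NotBound₂ Z (r ⟨ x , y ⟩)
  app   : NotBound₂ Z (X ⟨ x ⟩)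
  neg   : NotBound₂ Z φ → NotBound₂ Z (`¬ φ)
  conj  : ∀ {φ ψ} → NotBound₂ Z φ → NotBound₂ Z ψ → NotBound₂ Z (φ `∧ ψ)
  bind  : NotBound₂ Z φ → NotBound₂ Z (`∃ y ∙ φ)
  bind₂ : Y ≢ Z → NotBound₂ Z φ → NotBound₂ Z (`∃₂ Y ∙ φ)

replace-notBound : NotBound v φ → NotBound v (replace x z φ)
replace-notBound rel        = rel
replace-notBound app        = app
replace-notBound (neg n)    = neg (replace-notBound n)
replace-notBound (conj n m) = conj (replace-notBound n) (replace-notBound m)
replace-notBound {x = x} (bind {y = y} y≢v n) with y ≟ x
... | yes _ = bind y≢v n
... | no  _ = bind y≢v (replace-notBound n)
replace-notBound (bind₂ n)  = bind₂ (replace-notBound n)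

replace₂-notBound : NotBound₂ v φ → NotBound₂ v (replace₂ X Z φ)
replace₂-notBound rel        = rel
replace₂-notBound app        = app
replace₂-notBound (neg n)    = neg (replace₂-notBound n)
replace₂-notBound (conj n m) = conj (replace₂-notBound n) (replace₂-notBound m)
replace₂-notBound (bind n)   = bind (replace₂-notBound n)
replace₂-notBound {X = X} (bind₂ {Y = Y} Y≢v n) with Y ≟ X
... | yes _ = bind₂ Y≢v n
... | no  _ = bind₂ Y≢v (replace₂-notBound n)

rename-notBound : w ≢ z → ∀ φ → NotBound z (rename z w φ)
rename-notBound w≢z (r ⟨ x , y ⟩) = rel
rename-notBound w≢z (X ⟨ x ⟩)     = app
rename-notBound w≢z (`¬ φ)        = neg (rename-notBound w≢z φ)
rename-notBound w≢z (φ `∧ ψ)      = conj (rename-notBound w≢z φ) (rename-notBound w≢z ψ)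
rename-notBound {z = z} w≢z (`∃ y ∙ φ) with y ≟ z
... | yes _   = bind w≢z (replace-notBound (rename-notBound w≢z φ))
... | no  y≢z = bind y≢z (rename-notBound w≢z φ)
rename-notBound w≢z (`∃₂ X ∙ φ)   = bind₂ (rename-notBound w≢z φ)

rename₂-notBound : W ≢ Z → ∀ φ → NotBound₂ Z (rename₂ Z W φ)
rename₂-notBound W≢Z (r ⟨ x , y ⟩) = rel
rename₂-notBound W≢Z (X ⟨ x ⟩)     = app
rename₂-notBound W≢Z (`¬ φ)        = neg (rename₂-notBound W≢Z φ)
rename₂-notBound W≢Z (φ `∧ ψ)      = conj (rename₂-notBound W≢Z φ) (rename₂-notBound W≢Z ψ)
rename₂-notBound W≢Z (`∃ y ∙ φ)    = bind (rename₂-notBound W≢Z φ)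
rename₂-notBound {Z = Z} W≢Z (`∃₂ Y ∙ φ) with Y ≟ Z
... | yes _   = bind₂ W≢Z (replace₂-notBound (rename₂-notBound W≢Z φ))
... | no  Y≢Z = bind₂ Y≢Z (rename₂-notBound W≢Z φ)

-- The substitution lemma

module _ {U : Set ℓ} (I : Interpretation U) (D : Pred U ℓ) (E : Pred (Pred U ℓ) ℓ) where

  infix 4 _,_⊨_

  _,_⊨_ : (V → U) → (V₂ → Pred U ℓ) → Formula → Set (lsuc ℓ)
  g , G ⊨ φ = ⟨ I , D , E ⟩, g , G ⊨ᵈ φ

  private
    variable
      g g′ : V → U
      G G′ : V₂ → Pred U ℓ

  -- Atoms only test membership in second-order values, so `≐` suffices there. Under a quantifier
  -- both sides receive the same witness, which preserves the agreement.
  ⊨-coincidence : ∀ φ → (∀ {y} → y ∈ₗ vars φ → g y ≡ g′ y) →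
    (∀ {Y} → Y ∈ₗ vars₂ φ → G Y ≐ G′ Y) → g , G ⊨ φ ⇔ g′ , G′ ⊨ φ
  ⊨-coincidence (r ⟨ x , y ⟩) e e₂ rewrite e (here refl) | e (there (here refl)) = mk⇔ id id
  ⊨-coincidence (X ⟨ x ⟩) e e₂ rewrite e (here refl) =
    mk⇔ (λ (lift p) → lift (proj₁ (e₂ (here refl)) p))
        (λ (lift p) → lift (proj₂ (e₂ (here refl)) p))
  ⊨-coincidence (`¬ φ) e e₂ = ¬-cong-⇔ (⊨-coincidence φ e e₂)
  ⊨-coincidence (φ `∧ ψ) e e₂ =
    ⊨-coincidence φ (e ∘ ∈-++⁺ˡ) (e₂ ∘ ∈-++⁺ˡ) ×-⇔
    ⊨-coincidence ψ (e ∘ ∈-++⁺ʳ (vars φ)) (e₂ ∘ ∈-++⁺ʳ (vars₂ φ))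
  ⊨-coincidence {g = g} {g′ = g′} (`∃ y ∙ φ) e e₂ = ∃-cong-⇔ λ d → mk⇔ id id ×-⇔
    ⊨-coincidence φ (λ {v} v∈φ → update-cong g g′ v refl λ _ → e (there v∈φ)) e₂
  ⊨-coincidence {G = G} {G′ = G′} (`∃₂ Y ∙ φ) e e₂ = ∃-cong-⇔ λ S → mk⇔ id id ×-⇔
    ⊨-coincidence φ e (λ {V} V∈φ → update-rel _≐_ G G′ V ≐-refl λ _ → e₂ (there V∈φ))

  ⊨-cong : ∀ φ → (∀ {y} → y ∈ₗ vars φ → g y ≡ g′ y) → g , G ⊨ φ ⇔ g′ , G ⊨ φ
  ⊨-cong φ e = ⊨-coincidence φ e (λ _ → ≐-refl)

  ⊨-cong₂ : ∀ φ → (∀ {Y} → Y ∈ₗ vars₂ φ → G Y ≡ G′ Y) → g , G ⊨ φ ⇔ g , G′ ⊨ φ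
  ⊨-cong₂ φ e = ⊨-coincidence φ (λ _ → refl) (λ Y∈φ → ≡⇒≐ (e Y∈φ))

  -- No binder passed on the way to an occurrence of `x` updates `z`, so the substituted `z` still
  -- evaluates to `g z` there.
  ⊨-replace : NotBound z φ → g , G ⊨ replace x z φ ⇔ g [ x ← g z ] , G ⊨ φ
  ⊨-replace {z = z} {g = g} {x = x} (rel {r} {y} {y′})
    rewrite update-id {x = x} {z} g y | update-id {x = x} {z} g y′ = mk⇔ id id
  ⊨-replace {z = z} {g = g} {x = x} (app {x = y})
    rewrite update-id {x = x} {z} g y = mk⇔ id id
  ⊨-replace (neg n)    = ¬-cong-⇔ (⊨-replace n)
  ⊨-replace (conj n m) = ⊨-replace n ×-⇔ ⊨-replace m
  ⊨-replace {g = g} {x = x} (bind {y = y} {φ = φ} y≢z n) with y ≟ x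
  -- Replacement stops at a binder of `x`, and on the other side its witness overwrites the value
  -- `g z`.
  ... | yes refl = ∃-cong-⇔ λ d → mk⇔ id id ×-⇔ ⊨-cong φ (λ {v} _ → update-overwrite g v)
  -- The induction hypothesis looks up `z` after the update at `y`; this is still `g z`, and the two
  -- updates commute.
  ... | no  y≢x  = ∃-cong-⇔ λ d → mk⇔ id id ×-⇔
    (⊨-cong φ (λ {v} _ → update-comm g v y≢x (update-other g (y≢z ∘ sym))) ⇔-∘ ⊨-replace n)
  ⊨-replace (bind₂ n)  = ∃-cong-⇔ λ S → mk⇔ id id ×-⇔ ⊨-replace n

  ⊨-replace₂ : NotBound₂ Z φ → g , G ⊨ replace₂ X Z φ ⇔ g , G [ X ← G Z ] ⊨ φ
  ⊨-replace₂ rel = mk⇔ id id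
  ⊨-replace₂ {Z = Z} {G = G} {X = X} (app {X = Y})
    rewrite update-id {x = X} {Z} G Y = mk⇔ id id
  ⊨-replace₂ (neg n)    = ¬-cong-⇔ (⊨-replace₂ n)
  ⊨-replace₂ (conj n m) = ⊨-replace₂ n ×-⇔ ⊨-replace₂ m
  ⊨-replace₂ (bind n)   = ∃-cong-⇔ λ d → mk⇔ id id ×-⇔ ⊨-replace₂ n
  ⊨-replace₂ {G = G} {X = X} (bind₂ {Y = Y} {φ = φ} Y≢Z n) with Y ≟ X
  ... | yes refl = ∃-cong-⇔ λ S → mk⇔ id id ×-⇔ ⊨-cong₂ φ (λ {v} _ → update-overwrite G v)
  ... | no  Y≢X  = ∃-cong-⇔ λ S → mk⇔ id id ×-⇔
    (⊨-cong₂ φ (λ {v} _ → update-comm G v Y≢X (update-other G (Y≢Z ∘ sym))) ⇔-∘ ⊨-replace₂ n)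

  -- ⊨-replace does not apply here, since rename z w φ may bind w. Under such a binder
  -- every free z has already become w, so replacing once more changes nothing.
  ⊨-replace-rename : w ≢ z → ∀ φ → w ∉ₗ vars φ →
    g , G ⊨ replace z w (rename z w φ) ⇔ g [ z ← g w ] , G ⊨ φ
  ⊨-replace-rename {w = w} {z = z} {g = g} {G = G} w≢z (r ⟨ x , y ⟩) w∉φ =
    ⊨-replace {z = w} {φ = r ⟨ x , y ⟩} {g = g} {G = G} {x = z} rel
  ⊨-replace-rename {w = w} {z = z} {g = g} {G = G} w≢z (X ⟨ x ⟩) w∉φ =
    ⊨-replace {z = w} {φ = X ⟨ x ⟩} {g = g} {G = G} {x = z} app
  ⊨-replace-rename w≢z (`¬ φ)        w∉φ = ¬-cong-⇔ (⊨-replace-rename w≢z φ w∉φ)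
  ⊨-replace-rename w≢z (φ `∧ ψ)      w∉φ =
    ⊨-replace-rename w≢z φ (w∉φ ∘ ∈-++⁺ˡ) ×-⇔
    ⊨-replace-rename w≢z ψ (w∉φ ∘ ∈-++⁺ʳ (vars φ))
  ⊨-replace-rename {w = w} {z = z} {g = g} w≢z (`∃ y ∙ φ) w∉φ with y ≟ z
  -- The renamed formula now starts with a binder of `w`, so the outer `replace` compares `w` with
  -- `z`.
  ⊨-replace-rename {w = w} {z = z} {g = g} w≢z (`∃ z ∙ φ) w∉φ | yes refl with w ≟ z
  ... | yes w≡z = contradiction w≡z w≢z
  ... | no  _ rewrite replace-idem w≢z (rename z w φ) = ∃-cong-⇔ λ d → mk⇔ id id ×-⇔
    -- Both assignments send `z` to `d`. Elsewhere they can differ only at `w`, which does not occur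
    -- in `φ`.
    (⊨-cong φ (λ {v} v∈φ → update-cong (g [ w ← d ]) (g [ z ← g w ]) v (update-same g w d)
      λ v≢z → trans (update-other g {d} λ { refl → w∉φ (there v∈φ) }) (sym (update-other g v≢z)))
    ⇔-∘ ⊨-replace-rename w≢z φ (w∉φ ∘ there))
  -- The binder `y` was kept by `rename`, so the same test arises a second time in the outer
  -- `replace`.
  ⊨-replace-rename {w = w} {z = z} {g = g} w≢z (`∃ y ∙ φ) w∉φ | no y≢z with y ≟ z
  ... | yes y≡z = contradiction y≡z y≢z
  ... | no  _ = ∃-cong-⇔ λ d → mk⇔ id id ×-⇔
    -- Here `w` differs from `y` because `vars` also lists bound variables.
    (⊨-cong φ (λ {v} _ → update-comm g v y≢z (update-other g (w∉φ ∘ here)))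
    ⇔-∘ ⊨-replace-rename w≢z φ (w∉φ ∘ there))
  ⊨-replace-rename w≢z (`∃₂ X ∙ φ) w∉φ =
    ∃-cong-⇔ λ S → mk⇔ id id ×-⇔ ⊨-replace-rename w≢z φ w∉φ

  ⊨-replace-rename₂ : W ≢ Z → ∀ φ → W ∉ₗ vars₂ φ →
    g , G ⊨ replace₂ Z W (rename₂ Z W φ) ⇔ g , G [ Z ← G W ] ⊨ φ
  ⊨-replace-rename₂ {W = W} {Z = Z} {g = g} {G = G} W≢Z (r ⟨ x , y ⟩) W∉φ =
    ⊨-replace₂ {Z = W} {φ = r ⟨ x , y ⟩} {g = g} {G = G} {X = Z} rel
  ⊨-replace-rename₂ {W = W} {Z = Z} {g = g} {G = G} W≢Z (X ⟨ x ⟩) W∉φ =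
    ⊨-replace₂ {Z = W} {φ = X ⟨ x ⟩} {g = g} {G = G} {X = Z} app
  ⊨-replace-rename₂ W≢Z (`¬ φ)        W∉φ = ¬-cong-⇔ (⊨-replace-rename₂ W≢Z φ W∉φ)
  ⊨-replace-rename₂ W≢Z (φ `∧ ψ)      W∉φ =
    ⊨-replace-rename₂ W≢Z φ (W∉φ ∘ ∈-++⁺ˡ) ×-⇔
    ⊨-replace-rename₂ W≢Z ψ (W∉φ ∘ ∈-++⁺ʳ (vars₂ φ))
  ⊨-replace-rename₂ W≢Z (`∃ y ∙ φ) W∉φ =
    ∃-cong-⇔ λ d → mk⇔ id id ×-⇔ ⊨-replace-rename₂ W≢Z φ W∉φ
  ⊨-replace-rename₂ {W = W} {Z = Z} {G = G} W≢Z (`∃₂ Y ∙ φ) W∉φ with Y ≟ Z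
  ⊨-replace-rename₂ {W = W} {Z = Z} {G = G} W≢Z (`∃₂ Z ∙ φ) W∉φ | yes refl with W ≟ Z
  ... | yes W≡Z = contradiction W≡Z W≢Z
  ... | no  _ rewrite replace₂-idem W≢Z (rename₂ Z W φ) = ∃-cong-⇔ λ S → mk⇔ id id ×-⇔
    (⊨-cong₂ φ (λ {V} V∈φ → update-cong (G [ W ← S ]) (G [ Z ← G W ]) V (update-same G W S)
      λ V≢Z → trans (update-other G {S} λ { refl → W∉φ (there V∈φ) }) (sym (update-other G V≢Z)))
    ⇔-∘ ⊨-replace-rename₂ W≢Z φ (W∉φ ∘ there))
  ⊨-replace-rename₂ {W = W} {Z = Z} {G = G} W≢Z (`∃₂ Y ∙ φ) W∉φ | no Y≢Z with Y ≟ Z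
  ... | yes Y≡Z = contradiction Y≡Z Y≢Z
  ... | no  _ = ∃-cong-⇔ λ S → mk⇔ id id ×-⇔
    (⊨-cong₂ φ (λ {v} _ → update-comm G v Y≢Z (update-other G (W∉φ ∘ here)))
    ⇔-∘ ⊨-replace-rename₂ W≢Z φ (W∉φ ∘ there))

  -- At a renamed binder the witness is stored at `w`; `⊨-replace-rename` carries it back to `z`,
  -- and the leftover update at `w` is invisible to `φ`.
  ⊨-rename : w ≢ z → ∀ φ → w ∉ₗ vars φ → g , G ⊨ rename z w φ ⇔ g , G ⊨ φ
  ⊨-rename w≢z (r ⟨ x , y ⟩) w∉φ = mk⇔ id id
  ⊨-rename w≢z (X ⟨ x ⟩)     w∉φ = mk⇔ id id
  ⊨-rename w≢z (`¬ φ)        w∉φ = ¬-cong-⇔ (⊨-rename w≢z φ w∉φ)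
  ⊨-rename w≢z (φ `∧ ψ)      w∉φ =
    ⊨-rename w≢z φ (w∉φ ∘ ∈-++⁺ˡ) ×-⇔ ⊨-rename w≢z ψ (w∉φ ∘ ∈-++⁺ʳ (vars φ))
  ⊨-rename {w = w} {z = z} {g = g} w≢z (`∃ y ∙ φ) w∉φ with y ≟ z
  ... | yes refl = ∃-cong-⇔ λ d → mk⇔ id id ×-⇔
    (⊨-cong φ (λ {v} v∈φ → update-cong (g [ w ← d ]) g v (update-same g w d)
      λ _ → update-other g {d} λ { refl → w∉φ (there v∈φ) })
    ⇔-∘ ⊨-replace-rename w≢z φ (w∉φ ∘ there))
  ... | no _ = ∃-cong-⇔ λ d → mk⇔ id id ×-⇔ ⊨-rename w≢z φ (w∉φ ∘ there)
  ⊨-rename w≢z (`∃₂ X ∙ φ) w∉φ = ∃-cong-⇔ λ S → mk⇔ id id ×-⇔ ⊨-rename w≢z φ w∉φ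

  ⊨-rename₂ : W ≢ Z → ∀ φ → W ∉ₗ vars₂ φ → g , G ⊨ rename₂ Z W φ ⇔ g , G ⊨ φ
  ⊨-rename₂ W≢Z (r ⟨ x , y ⟩) W∉φ = mk⇔ id id
  ⊨-rename₂ W≢Z (X ⟨ x ⟩)     W∉φ = mk⇔ id id
  ⊨-rename₂ W≢Z (`¬ φ)        W∉φ = ¬-cong-⇔ (⊨-rename₂ W≢Z φ W∉φ)
  ⊨-rename₂ W≢Z (φ `∧ ψ)      W∉φ =
    ⊨-rename₂ W≢Z φ (W∉φ ∘ ∈-++⁺ˡ) ×-⇔ ⊨-rename₂ W≢Z ψ (W∉φ ∘ ∈-++⁺ʳ (vars₂ φ))
  ⊨-rename₂ W≢Z (`∃ y ∙ φ) W∉φ = ∃-cong-⇔ λ d → mk⇔ id id ×-⇔ ⊨-rename₂ W≢Z φ W∉φ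
  ⊨-rename₂ {W = W} {Z = Z} {G = G} W≢Z (`∃₂ Y ∙ φ) W∉φ with Y ≟ Z
  ... | yes refl = ∃-cong-⇔ λ S → mk⇔ id id ×-⇔
    (⊨-cong₂ φ (λ {V} V∈φ → update-cong (G [ W ← S ]) G V (update-same G W S)
      λ _ → update-other G {S} λ { refl → W∉φ (there V∈φ) })
    ⇔-∘ ⊨-replace-rename₂ W≢Z φ (W∉φ ∘ there))
  ... | no _ = ∃-cong-⇔ λ S → mk⇔ id id ×-⇔ ⊨-rename₂ W≢Z φ (W∉φ ∘ there)

  -- Renaming preserves truth and removes all binders of `z`, which is what `⊨-replace` requires.
  -- Including `z` in the list given to `fresh` makes the new variable differ from it.
  ⊨-subst : ∀ x z φ → g , G ⊨ [ x ←ᵣ z ] φ ⇔ g [ x ← g z ] , G ⊨ φ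
  ⊨-subst x z φ =
    ⊨-rename w≢z φ (w∉ ∘ there ∘ there) ⇔-∘ ⊨-replace (rename-notBound w≢z φ)
    where
    w∉ = fresh-∉ (x ∷ z ∷ vars φ)
    w≢z : fresh (x ∷ z ∷ vars φ) ≢ z
    w≢z = w∉ ∘ there ∘ here

  ⊨-subst₂ : ∀ X Z φ → g , G ⊨ [ X ←ᵣ₂ Z ] φ ⇔ g , G [ X ← G Z ] ⊨ φ
  ⊨-subst₂ X Z φ =
    ⊨-rename₂ W≢Z φ (W∉ ∘ there ∘ there) ⇔-∘ ⊨-replace₂ (rename₂-notBound W≢Z φ)
    where
    W∉ = fresh-∉ (X ∷ Z ∷ vars₂ φ)
    W≢Z : fresh (X ∷ Z ∷ vars₂ φ) ≢ Z
    W≢Z = W∉ ∘ there ∘ here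

-- Shallow and deep truth

module _ {U : Set ℓ} where

  -- Opened only here: elsewhere _,_ makes patterns r ⟨ x , y ⟩ ambiguous.
  open import Data.Product using (_,_)

  -- Each element of the range is named by a variable, so the shallow quantifier over names becomes
  -- the deep one over values.
  ∃-Range : {g : V → U} {P : U → Set p} → ∃ (λ z → P (g z)) ⇔ ∃ (λ d → d ∈ Range g × P d)
  ∃-Range {g = g} = mk⇔ (λ (z , p) → g z , (z , refl) , p) (λ { (_ , (z , refl) , p) → z , p })

  -- A member of `Range₂ G` is only extensionally equal to some `G Z`, hence the demand that `P`
  -- respect `≐`.
  ∃-Range₂ : {G : V₂ → Pred U ℓ} {P : Pred U ℓ → Set p} → (∀ {S T} → S ≐ T → P S → P T) →
    ∃ (λ Z → P (G Z)) ⇔ ∃ (λ S → S ∈ Range₂ G × P S)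
  ∃-Range₂ {G = G} resp = mk⇔ (λ (Z , p) → G Z , (Z , ≐-refl) , p)
                      (λ (_ , (Z , GZ≐S) , p) → Z , resp (≐-sym GZ≐S) p)

module _ {U : Set ℓ} (I : Interpretation U) (g : V → U) (G : V₂ → Pred U ℓ) where

  private
    D = Range g
    E = Range₂ G

  -- The induction follows the accessibility proof, since `[ x ←ᵣ z ] φ` is no subformula.
  -- Quantifying over all such proofs lets the hypothesis apply to whichever one `shallow` passes
  -- on.
  shallow⇔deep : ∀ φ (rec : Acc _<_ (size φ)) →
    shallow I g G φ rec ⇔ (⟨ I , D , E ⟩, g , G ⊨ᵈ φ)
  shallow⇔deep (r ⟨ x , y ⟩) _        = mk⇔ lift λ (lift p) → p
  shallow⇔deep (X ⟨ x ⟩)     _        = mk⇔ lift λ (lift p) → p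
  shallow⇔deep (`¬ φ)        (acc rs) = ¬-cong-⇔ (shallow⇔deep φ _)
  shallow⇔deep (φ `∧ ψ)      (acc rs) = shallow⇔deep φ _ ×-⇔ shallow⇔deep ψ _
  -- From right to left: the induction hypothesis makes the substituted body deep, `⊨-subst` turns
  -- substitution into an update, and `∃-Range` trades variables for values.
  shallow⇔deep (`∃ x ∙ φ)    (acc rs) = ∃-Range ⇔-∘ ∃-cong-⇔ λ z →
    ⊨-subst I D E x z φ ⇔-∘ shallow⇔deep ([ x ←ᵣ z ] φ) _
  shallow⇔deep (`∃₂ X ∙ φ)   (acc rs) = ∃-Range₂ resp ⇔-∘ ∃-cong-⇔ λ Z →
    ⊨-subst₂ I D E X Z φ ⇔-∘ shallow⇔deep ([ X ←ᵣ₂ Z ] φ) _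
    where
    resp : ∀ {S T} → S ≐ T →
      (⟨ I , D , E ⟩, g , G [ X ← S ] ⊨ᵈ φ) → (⟨ I , D , E ⟩, g , G [ X ← T ] ⊨ᵈ φ)
    resp S≐T = Equivalence.to
      (⊨-coincidence I D E φ (λ _ → refl) (λ {V} _ → update-rel _≐_ G G V S≐T λ _ → ≐-refl))

mainTheorem2 : ∀ {ℓ : Level} (U : Set ℓ) → U → (φ : Formula) →
    (∀ (II : Interpretation U) (gg : V → U) (GG : V₂ → Pred U ℓ) → ⦅ φ ⦆ II gg GG)
    ⇔
    (∀ (I : Interpretation U) (g : V → U) (G : V₂ → Pred U ℓ) →
    ⟨ I , Range g , Range₂ G ⟩, g , G ⊨ᵈ φ)
mainTheorem2 U _ φ = mk⇔
  (λ valid I g G → Equivalence.to (shallow⇔deep I g G φ _) (valid I g G))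
  (λ valid I g G → Equivalence.from (shallow⇔deep I g G φ (<-wellFounded (size φ))) (valid I g G))
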